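{- Let $n$ be an odd positive integer and $S=\{0,\dots,n-1\}$. For $q=1,2,3,4$ let $\alpha_{1q},\dots,\alpha_{4q}\in\{1,\dots,n-1\}$ be such that, for each $q$, writing $\alpha_m=\alpha_{mq}$ and $B=\alpha_1+\alpha_2+\alpha_3+\alpha_4$, for all $m\ne m'$ in $\{1,2,3,4\}$: $\gcd(\alpha_m,n)=1$; $\gcd(\alpha_m\pm\alpha_{m'},n)=1$; $\gcd(B-\alpha_m,n)=1$; $\gcd(B,n)=1$; $\gcd(B-2\alpha_m,n)=1$; $\gcd(B-\alpha_{m'}-2\alpha_m,n)=1$; $\gcd(B-2\alpha_{m'}-2\alpha_m,n)=1$; and suppose $\gcd(\det(\alpha_{pq})_{p,q=1}^4,n)=1$. Let $Q^{(q)}_{ijk\ell}\equiv\alpha_{1q}i+\alpha_{2q}j+\alpha_{3q}k+\alpha_{4q}\ell\pmod n$ with entries in $S$ (four orthogonal 4-D pandiagonal latin cubes), and define $M^{(4)}=n^3Q^{(1)}+n^2Q^{(2)}+nQ^{(3)}+Q^{(4)}$ entrywise. Then $M^{(4)}$ is a magic pandiagonal four-dimensional cube.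
   Context: For an $n\times n$ array indexed by $(x,y)\in S^2$, its ROWS are, for each $c\in S$, the index sets $\{(x,c)\}_x$, $\{(c,y)\}_y$, $\{(x,x+c\bmod n)\}_x$, $\{(x,c-x\bmod n)\}_x$. The constituent squares of an $n\times n\times n$ array are the $3n$ squares obtained by fixing one coordinate, and the six squares obtained by imposing, for one pair of coordinates $(a,b)$, either $x_a=x_b$ or $x_a+x_b=n-1$. The constituent 3-D cubes of an $n\times n\times n\times n$ array are the $4n$ cubes obtained by fixing one coordinate, and the $12$ cubes obtained by imposing, for one of the 6 pairs of coordinates $(a,b)$, either $x_a=x_b$ or $x_a+x_b=n-1$. An $n\times n\times n\times n$ array $M$ is a magic pandiagonal 4-D cube if its entries are exactly the integers $0,1,\dots,n^4-1$, each once, and the sum of the entries along every ROW of every constituent square of every constituent 3-D cube equals $n(n^4-1)/2$. -}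

module Defs where

open import Data.Nat using (ℕ; zero; suc; _+_; _*_; _∸_; _^_; _<_; NonZero)
open import Data.Nat.DivMod using (_%_; _/_)
open import Data.Fin using (Fin; zero; suc; toℕ; punchIn)
open import Data.List using (List; map; upTo)
open import Data.Nat.ListAction using (sum)
open import Data.Vec.Functional using (Vector; insertAt; _∷_; [])
open import Data.Product using (_×_; Σ)
open import Data.Unit using (⊤)
open import Relation.Binary.PropositionalEquality using (_≡_)
open import Relation.Nullary using (¬_)
open import Data.Integer as ℤ using (ℤ; +_; 1ℤ)
open import Data.Integer.GCD using (gcd)

Σ< : ℕ → (ℕ → ℕ) → ℕ
Σ< n f = sum (map f (upTo n))

CoprimeTo : ℤ → ℕ → Set
CoprimeTo x n = gcd x (+ n) ≡ 1ℤ

ℤΣ : (k : ℕ) → (Fin k → ℤ) → ℤ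
ℤΣ zero    f = + 0
ℤΣ (suc k) f = f zero ℤ.+ ℤΣ k (λ i → f (suc i))

sign : ℕ → ℤ
sign zero          = + 1
sign (suc zero)    = ℤ.- (+ 1)
sign (suc (suc j)) = sign j

det : (k : ℕ) → (Fin k → Fin k → ℤ) → ℤ
det zero    A = + 1
det (suc k) A =
  ℤΣ (suc k) (λ j → sign (toℕ j) ℤ.* (A zero j ℤ.* det k (λ r c → A (suc r) (punchIn j c))))

-- Arrays: a k-dimensional n×…×n array is a function on index tuples
-- (Fin k → ℕ); only tuples with all coordinates in S = {0,…,n-1} matter.

Point : ℕ → Set
Point k = Fin k → ℕ

InS : ℕ → {k : ℕ} → Point k → Set
InS n x = ∀ i → x i < n

-- Constituent (k)-dimensional sub-arrays of a (k+1)-dimensional array: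
--  fix i c   : coordinate i fixed to c             ((k+1)·n of them)
--  diag b a  : coordinate b equal to remaining coordinate a  (x_b = x_a)
--  anti b a  : x_b + x_a = n - 1
-- (diag/anti with the roles of the two coordinates swapped give the same
--  sub-array up to relabelling/reflection of one axis.)
data Con (k : ℕ) : Set where
  fix  : Fin (suc k) → ℕ → Con k
  diag : Fin (suc k) → Fin k → Con k
  anti : Fin (suc k) → Fin k → Con k

Valid : ℕ → {k : ℕ} → Con k → Set
Valid n (fix i c)  = c < n
Valid n (diag b a) = ⊤
Valid n (anti b a) = ⊤

embed : ℕ → {k : ℕ} → Con k → Point k → Point (suc k)
embed n (fix i c)  x = insertAt x i c
embed n (diag b a) x = insertAt x b (x a)
embed n (anti b a) x = insertAt x b (n ∸ 1 ∸ x a)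

sub : ℕ → {k : ℕ} → Con k → (Point (suc k) → ℕ) → (Point k → ℕ)
sub n e A x = A (embed n e x)

RowsSumTo : (n : ℕ) → .{{NonZero n}} → (Point 2 → ℕ) → ℕ → Set
RowsSumTo n A s = ∀ c → c < n →
    (Σ< n (λ x → A (x ∷ c ∷ [])) ≡ s)
  × (Σ< n (λ y → A (c ∷ y ∷ [])) ≡ s)
  × (Σ< n (λ x → A (x ∷ ((x + c) % n) ∷ [])) ≡ s)
  × (Σ< n (λ x → A (x ∷ ((c + (n ∸ x)) % n) ∷ [])) ≡ s)

IsMagicPandiagonal4D : (n : ℕ) → .{{NonZero n}} → (Point 4 → ℕ) → Set
IsMagicPandiagonal4D n M =
    (∀ x → InS n x → M x < n ^ 4)
  × (∀ m → m < n ^ 4 →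
       Σ (Point 4) λ x → (InS n x × M x ≡ m)
                        × (∀ y → InS n y → M y ≡ m → ∀ i → y i ≡ x i))
  × (∀ (e₁ : Con 3) → Valid n e₁ → ∀ (e₂ : Con 2) → Valid n e₂ →
       RowsSumTo n (sub n e₂ (sub n e₁ M)) (n * (n ^ 4 ∸ 1) / 2))

ColumnConditions : ℕ → (Fin 4 → ℕ) → Set
ColumnConditions n a =
  ∀ m m' → ¬ (m ≡ m') →
      CoprimeTo (+ a m) n
    × CoprimeTo (+ a m ℤ.+ + a m') n
    × CoprimeTo (+ a m ℤ.- + a m') n
    × CoprimeTo (B ℤ.- + a m) n
    × CoprimeTo B n
    × CoprimeTo (B ℤ.- + 2 ℤ.* + a m) n
    × CoprimeTo (B ℤ.- + a m' ℤ.- + 2 ℤ.* + a m) n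
    × CoprimeTo (B ℤ.- + 2 ℤ.* + a m' ℤ.- + 2 ℤ.* + a m) n
  where
  B : ℤ
  B = + (a zero + a (suc zero) + a (suc (suc zero)) + a (suc (suc (suc zero))))

-- Latin cubes Q^{(q)} and the cube M^{(4)}; α p q = α_{(p+1)(q+1)}

Qcube : (n : ℕ) → .{{NonZero n}} → (Fin 4 → Fin 4 → ℕ) → Fin 4 → Point 4 → ℕ
Qcube n α q x =
  (α zero q * x zero + α (suc zero) q * x (suc zero)
   + α (suc (suc zero)) q * x (suc (suc zero))
   + α (suc (suc (suc zero))) q * x (suc (suc (suc zero)))) % n

M4 : (n : ℕ) → .{{NonZero n}} → (Fin 4 → Fin 4 → ℕ) → Point 4 → ℕ
M4 n α x =
    n ^ 3 * Qcube n α zero x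
  + n ^ 2 * Qcube n α (suc zero) x
  + n * Qcube n α (suc (suc zero)) x
  + Qcube n α (suc (suc (suc zero))) x

{-# OPTIONS --safe #-}
-- Along every ROW each coordinate is congruent to s·t + c with a slope
-- s ∈ {-1, 0, 1}, and not all four slopes vanish.  Hence each Q^(q) is
-- congruent to u·t + c along the ROW, where u = Σ sₘ αₘ.  The coprimality
-- conditions say exactly that all such u are units modulo n, so Q^(q) runs
-- through a permutation of S and contributes n(n-1)/2.  That the entries of M
-- are 0, …, n⁴-1 is uniqueness of base-n digits together with Cramer's rule
-- modulo n and the pigeonhole principle.
module Submission where

open import Defs
open import Data.Nat using (ℕ; zero; suc; s≤s; _<_; _≤_; NonZero)
import Data.Nat as ℕ
open import Data.Nat.DivMod using (_%_; m≡m%n+[m/n]*n; m%n<n; m*n/n≡m)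
import Data.Nat.Properties as ℕ
import Data.Nat.Divisibility as ℕ
import Data.Nat.Coprimality as ℕ using (sym; gcd≡1⇒coprime)
open import Data.Nat.ListAction.Properties using (sum-++)
open import Data.Nat.ListAction using (sum)
import Data.Nat.Tactic.RingSolver as ℕ using (solve-∀)
open import Data.Fin using (Fin; zero; suc; toℕ; fromℕ<; punchIn; punchOut; combine; opposite; funToFin; finToFun)
open import Data.Fin.Patterns
open import Data.Fin.Properties using (_≟_; any?; all?; injective⇒≤)
open import Data.Fin.Properties using (punchOut-injective; toℕ-injective; toℕ-fromℕ<; toℕ<n; toℕ-combine; fromℕ<-injective; finToFun-funToFin; funToFin-finToFin)
open import Data.Fin.Permutation using (permutation)
open import Data.List using (List; []; _∷_; applyUpTo; _∷ʳ_)
open import Data.List.Properties using (map-upTo; applyUpTo-∷ʳ)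
open import Data.List.Relation.Unary.All as All using (All; []; _∷_)
open import Data.List.Relation.Unary.Any as Any using (Any)
open import Data.Vec using (Vec; []; _∷_; zipWith; replicate)
import Data.Vec as Vec
import Data.Vec.Properties as Vec
open import Data.Vec.Functional using (insertAt)
import Data.Vec.Functional as Vector
open import Data.Vec.Functional.Properties using (insertAt-punchIn)
open import Data.Product using (Σ; ∃; ∃₂; _×_; _,_; proj₁; proj₂)
open import Data.Sum using (_⊎_; [_,_]′)
open import Data.Integer using (ℤ; +_; _+_; _*_; _-_; -_; ∣_∣; -1ℤ; 0ℤ; 1ℤ)
import Data.Integer.Properties as ℤ
open import Data.Integer.Coprimality using (coprime-divisor)
open import Data.Integer.Divisibility.Signed using (_∣_; divides; ∣⇒∣ᵤ; ∣ᵤ⇒∣; ∣m∣n⇒∣m+n; ∣m∣n⇒∣m-n; ∣m⇒∣m*n)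
open import Data.Integer.Tactic.RingSolver using (solve-∀)
open import Algebra.Properties.CommutativeMonoid.Sum ℕ.+-0-commutativeMonoid as FinSum using (sum-permute; sum-cong-≗)
open import Function using (_∘_; id)
open import Function.Definitions using (Injective)
open import Relation.Nullary using (Dec; yes; no; contradiction)
open import Relation.Nullary.Decidable using (_⊎-dec_; _×-dec_; ¬?; toWitness)
open import Relation.Binary.PropositionalEquality using (_≡_; _≢_; refl; sym; trans; cong; cong₂; subst; module ≡-Reasoning)

-- Determinants

-- The left side is exactly what `det 2` unfolds to, with its signs, empty minors and final zero, so
-- later uses need no rewriting.
expand₂ : ∀ a b c d →
  + 1 * (a * (+ 1 * (d * + 1) + + 0)) + (- (+ 1) * (b * (+ 1 * (c * + 1) + + 0)) + + 0) ≡
  a * d - b * c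
expand₂ = solve-∀

expand₃ : ∀ x y z {p q r p′ q′ r′} → p ≡ p′ → q ≡ q′ → r ≡ r′ →
  + 1 * (x * p) + (- (+ 1) * (y * q) + (+ 1 * (z * r) + + 0)) ≡ x * p′ - y * q′ + z * r′
expand₃ x y z {p} {q} {r} refl refl refl = lemma x y z p q r
  where
  lemma : ∀ x y z p q r →
    + 1 * (x * p) + (- (+ 1) * (y * q) + (+ 1 * (z * r) + + 0)) ≡ x * p - y * q + z * r
  lemma = solve-∀

expand₄ : ∀ w x y z {p q r s p′ q′ r′ s′} → p ≡ p′ → q ≡ q′ → r ≡ r′ → s ≡ s′ →
  + 1 * (w * p) + (- (+ 1) * (x * q) + (+ 1 * (y * r) + (- (+ 1) * (z * s) + + 0))) ≡
  w * p′ - x * q′ + y * r′ - z * s′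
expand₄ w x y z {p} {q} {r} {s} refl refl refl refl = lemma w x y z p q r s
  where
  lemma : ∀ w x y z p q r s →
    + 1 * (w * p) + (- (+ 1) * (x * q) + (+ 1 * (y * r) + (- (+ 1) * (z * s) + + 0))) ≡
    w * p - x * q + y * r - z * s
  lemma = solve-∀

-- Minors are indexed by the columns kept rather than those deleted, so that one minor can be shared
-- by several expansions.
det2 : (a b : Fin 4 → ℤ) → Fin 4 → Fin 4 → ℤ
det2 a b i j = a i * b j - a j * b i

det3 : (a b c : Fin 4 → ℤ) → Fin 4 → Fin 4 → Fin 4 → ℤ
det3 a b c i j k = a i * det2 b c j k - a j * det2 b c i k + a k * det2 b c i j

det4 : (a b c d : Fin 4 → ℤ) → ℤ
det4 a b c d =
  a 0F * det3 b c d 1F 2F 3F - a 1F * det3 b c d 0F 2F 3F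
  + a 2F * det3 b c d 0F 1F 3F - a 3F * det3 b c d 0F 1F 2F

det≡det4 : ∀ (A : Fin 4 → Fin 4 → ℤ) → det 4 A ≡ det4 (A 0F) (A 1F) (A 2F) (A 3F)
det≡det4 A = expand₄ (A 0F 0F) (A 0F 1F) (A 0F 2F) (A 0F 3F)
  (minor₃ 1F 2F 3F) (minor₃ 0F 2F 3F) (minor₃ 0F 1F 3F) (minor₃ 0F 1F 2F)
  where
  -- The omitted side is inferred from `expand₂`; on concrete columns `punchIn` computes, and it
  -- agrees with the unfolded `det`.
  minor₂ : ∀ i j → _ ≡ det2 (A 2F) (A 3F) i j
  minor₂ i j = expand₂ (A 2F i) (A 2F j) (A 3F i) (A 3F j)

  minor₃ : ∀ i j k → _ ≡ det3 (A 1F) (A 2F) (A 3F) i j k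
  minor₃ i j k = expand₃ (A 1F i) (A 1F j) (A 1F k) (minor₂ j k) (minor₂ i k) (minor₂ i j)

det2-swap : ∀ a b i j → det2 a b i j ≡ - det2 b a i j
det2-swap a b i j = lemma (a i) (a j) (b i) (b j)
  where
  lemma : ∀ x y z w → x * w - y * z ≡ - (z * y - w * x)
  lemma = solve-∀

det3-swap₁ : ∀ a b c i j k → det3 a b c i j k ≡ - det3 b a c i j k
det3-swap₁ a b c i j k = lemma (a i) (a j) (a k) (b i) (b j) (b k) (c i) (c j) (c k)
  where
  lemma : ∀ x y z u v w p q r →
    x * (v * r - w * q) - y * (u * r - w * p) + z * (u * q - v * p) ≡
    - (u * (y * r - z * q) - v * (x * r - z * p) + w * (x * q - y * p))
  lemma = solve-∀

-- The expansion along `a` is linear in the 2×2 minors of the other two rows, and each of these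
-- changes sign.
det3-swap₂ : ∀ a b c i j k → det3 a b c i j k ≡ - det3 a c b i j k
det3-swap₂ a b c i j k
  rewrite det2-swap b c j k | det2-swap b c i k | det2-swap b c i j =
  lemma (a i) (a j) (a k) (det2 c b j k) (det2 c b i k) (det2 c b i j)
  where
  lemma : ∀ x y z u v w → x * - u - y * - v + z * - w ≡ - (x * u - y * v + z * w)
  lemma = solve-∀

-- The 2×2 minors of c and d are treated as unknowns, since the identity
-- expanded in all sixteen entries would be far larger.
det4-swap₁ : ∀ a b c d → det4 a b c d ≡ - det4 b a c d
det4-swap₁ a b c d =
  lemma (a 0F) (a 1F) (a 2F) (a 3F) (b 0F) (b 1F) (b 2F) (b 3F)
    (det2 c d 0F 1F) (det2 c d 0F 2F) (det2 c d 0F 3F)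
    (det2 c d 1F 2F) (det2 c d 1F 3F) (det2 c d 2F 3F)
  where
  lemma : ∀ a₀ a₁ a₂ a₃ b₀ b₁ b₂ b₃ p₀₁ p₀₂ p₀₃ p₁₂ p₁₃ p₂₃ →
    a₀ * (b₁ * p₂₃ - b₂ * p₁₃ + b₃ * p₁₂) - a₁ * (b₀ * p₂₃ - b₂ * p₀₃ + b₃ * p₀₂)
    + a₂ * (b₀ * p₁₃ - b₁ * p₀₃ + b₃ * p₀₁) - a₃ * (b₀ * p₁₂ - b₁ * p₀₂ + b₂ * p₀₁) ≡
    - (b₀ * (a₁ * p₂₃ - a₂ * p₁₃ + a₃ * p₁₂) - b₁ * (a₀ * p₂₃ - a₂ * p₀₃ + a₃ * p₀₂)
    + b₂ * (a₀ * p₁₃ - a₁ * p₀₃ + a₃ * p₀₁) - b₃ * (a₀ * p₁₂ - a₁ * p₀₂ + a₂ * p₀₁))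
  lemma = solve-∀

laplace-neg : ∀ w x y z {p q r s p′ q′ r′ s′} →
  p ≡ - p′ → q ≡ - q′ → r ≡ - r′ → s ≡ - s′ →
  w * p - x * q + y * r - z * s ≡ - (w * p′ - x * q′ + y * r′ - z * s′)
laplace-neg w x y z {p′ = p} {q} {r} {s} refl refl refl refl = lemma w x y z p q r s
  where
  lemma : ∀ w x y z p q r s →
    w * - p - x * - q + y * - r - z * - s ≡ - (w * p - x * q + y * r - z * s)
  lemma = solve-∀

det4-swap₂ : ∀ a b c d → det4 a b c d ≡ - det4 a c b d
det4-swap₂ a b c d = laplace-neg (a 0F) (a 1F) (a 2F) (a 3F)
  (swap 1F 2F 3F) (swap 0F 2F 3F) (swap 0F 1F 3F) (swap 0F 1F 2F)
  where
  swap : ∀ i j k → det3 b c d i j k ≡ - det3 c b d i j k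
  swap = det3-swap₁ b c d

det4-swap₃ : ∀ a b c d → det4 a b c d ≡ - det4 a b d c
det4-swap₃ a b c d = laplace-neg (a 0F) (a 1F) (a 2F) (a 3F)
  (swap 1F 2F 3F) (swap 0F 2F 3F) (swap 0F 1F 3F) (swap 0F 1F 2F)
  where
  swap : ∀ i j k → det3 b c d i j k ≡ - det3 b d c i j k
  swap = det3-swap₂ b c d

-- Antisymmetry alone would only make twice the value vanish; expanding with the 2×2 minors as
-- unknowns cancels directly.
det4-repeat₁ : ∀ a c d → det4 a a c d ≡ 0ℤ
det4-repeat₁ a c d =
  lemma (a 0F) (a 1F) (a 2F) (a 3F)
    (det2 c d 0F 1F) (det2 c d 0F 2F) (det2 c d 0F 3F)
    (det2 c d 1F 2F) (det2 c d 1F 3F) (det2 c d 2F 3F)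
  where
  lemma : ∀ b₀ b₁ b₂ b₃ p₀₁ p₀₂ p₀₃ p₁₂ p₁₃ p₂₃ →
    b₀ * (b₁ * p₂₃ - b₂ * p₁₃ + b₃ * p₁₂) - b₁ * (b₀ * p₂₃ - b₂ * p₀₃ + b₃ * p₀₂)
    + b₂ * (b₀ * p₁₃ - b₁ * p₀₃ + b₃ * p₀₁) - b₃ * (b₀ * p₁₂ - b₁ * p₀₂ + b₂ * p₀₁) ≡ + 0
  lemma = solve-∀

det4-repeat₂ : ∀ a b d → det4 a b a d ≡ 0ℤ
det4-repeat₂ a b d = trans (det4-swap₂ a b a d) (cong -_ (det4-repeat₁ a b d))

det4-repeat₃ : ∀ a b c → det4 a b c a ≡ 0ℤ
det4-repeat₃ a b c = trans (det4-swap₃ a b c a) (cong -_ (det4-repeat₂ a b c))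

combine₄ : (w x y z : ℤ) (a b c d : Fin 4 → ℤ) → Fin 4 → ℤ
combine₄ w x y z a b c d q = w * a q + x * b q + y * c q + z * d q

-- By linearity in the first row; the terms from `b`, `c` and `d` have a repeated row. This is the
-- identity behind Cramer's rule.
det4-linear : ∀ w x y z a b c d →
  det4 (combine₄ w x y z a b c d) b c d ≡ w * det4 a b c d
det4-linear w x y z a b c d = begin
  det4 (combine₄ w x y z a b c d) b c d
    ≡⟨ additive w x y z (a 0F) (a 1F) (a 2F) (a 3F) (b 0F) (b 1F) (b 2F) (b 3F)
         (c 0F) (c 1F) (c 2F) (c 3F) (d 0F) (d 1F) (d 2F) (d 3F)
         (det3 b c d 1F 2F 3F) (det3 b c d 0F 2F 3F) (det3 b c d 0F 1F 3F) (det3 b c d 0F 1F 2F) ⟩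
  w * det4 a b c d + x * det4 b b c d + y * det4 c b c d + z * det4 d b c d
    ≡⟨ vanish w x y z _ (det4-repeat₁ b c d) (det4-repeat₂ c b d) (det4-repeat₃ d b c) ⟩
  w * det4 a b c d ∎
  where
  open ≡-Reasoning

  additive : ∀ w x y z a₀ a₁ a₂ a₃ b₀ b₁ b₂ b₃ c₀ c₁ c₂ c₃ d₀ d₁ d₂ d₃ p q r s →
    (w * a₀ + x * b₀ + y * c₀ + z * d₀) * p - (w * a₁ + x * b₁ + y * c₁ + z * d₁) * q
    + (w * a₂ + x * b₂ + y * c₂ + z * d₂) * r - (w * a₃ + x * b₃ + y * c₃ + z * d₃) * s ≡
    w * (a₀ * p - a₁ * q + a₂ * r - a₃ * s) + x * (b₀ * p - b₁ * q + b₂ * r - b₃ * s)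
    + y * (c₀ * p - c₁ * q + c₂ * r - c₃ * s) + z * (d₀ * p - d₁ * q + d₂ * r - d₃ * s)
  additive = solve-∀

  vanish : ∀ w x y z p {q r s} → q ≡ 0ℤ → r ≡ 0ℤ → s ≡ 0ℤ →
    w * p + x * q + y * r + z * s ≡ w * p
  vanish w x y z p refl refl refl = lemma w x y z p
    where
    lemma : ∀ w x y z p → w * p + x * + 0 + y * + 0 + z * + 0 ≡ w * p
    lemma = solve-∀

-- Congruences

∣-resp-≡ : ∀ {k i j} → i ≡ j → k ∣ i → k ∣ j
∣-resp-≡ refl k∣i = k∣i

coprimeTo-neg : ∀ {n} i → CoprimeTo (- i) n → CoprimeTo i n
coprimeTo-neg i c rewrite ℤ.∣-i∣≡∣i∣ i = c

coprimeTo-cancel : ∀ {n} u z → CoprimeTo u n → + n ∣ u * z → + n ∣ z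
coprimeTo-cancel {n} u z c n∣uz =
  ∣ᵤ⇒∣ (coprime-divisor (+ n) u z (ℕ.sym (ℕ.gcd≡1⇒coprime (ℤ.+-injective c))) (∣⇒∣ᵤ n∣uz))

-- The distance of `x` and `y` is at most their maximum, hence below `n`, and so cannot be a nonzero
-- multiple of `n`.
residue-unique : ∀ {n x y} → x < n → y < n → + n ∣ + x - + y → x ≡ y
residue-unique {n} {x} {y} x<n y<n n∣x-y with ∣ + x - + y ∣ in eq
... | zero  = ℤ.+-injective (ℤ.i-j≡0⇒i≡j (+ x) (+ y) (ℤ.∣i∣≡0⇒i≡0 eq))
... | suc k = contradiction (subst (n ℕ.∣_) eq (∣⇒∣ᵤ n∣x-y))
  (ℕ.>⇒∤ (ℕ.≤-<-trans bound (ℕ.⊔-lub x<n y<n)))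
  where
  bound : suc k ≤ x ℕ.⊔ y
  bound rewrite sym eq | ℤ.m-n≡m⊖n x y = ℤ.∣m⊝n∣≤m⊔n x y

%-cong : ∀ m n .{{_ : NonZero n}} → + n ∣ + m - + (m % n)
%-cong m n = divides (+ (m ℕ./ n)) (begin
  + m - + (m % n)
    ≡⟨ cong (λ k → + k - + (m % n)) (m≡m%n+[m/n]*n m n) ⟩
  + (m % n) + + (m ℕ./ n ℕ.* n) - + (m % n)
    ≡⟨ cong (λ k → + (m % n) + k - + (m % n)) (ℤ.pos-* (m ℕ./ n) n) ⟩
  + (m % n) + + (m ℕ./ n) * + n - + (m % n)
    ≡⟨ lemma (+ (m % n)) _ ⟩
  + (m ℕ./ n) * + n ∎)
  where
  open ≡-Reasoning
  lemma : ∀ i j → i + j - i ≡ j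
  lemma = solve-∀

-- Put the combination in place of the first row: expanding along it gives a multiple of `n`, while
-- `det4-linear` gives `w` times a determinant that is a unit modulo `n`.
cramer : ∀ {n} w x y z (a b c d : Fin 4 → ℤ) → CoprimeTo (det4 a b c d) n →
  (∀ q → + n ∣ combine₄ w x y z a b c d q) → + n ∣ w
cramer w x y z a b c d cop n∣ = coprimeTo-cancel (det4 a b c d) w cop
  (∣-resp-≡ (trans (det4-linear w x y z a b c d) (ℤ.*-comm w _))
    (∣m∣n⇒∣m-n (∣m∣n⇒∣m+n (∣m∣n⇒∣m-n
      (∣m⇒∣m*n (det3 b c d 1F 2F 3F) (n∣ 0F)) (∣m⇒∣m*n (det3 b c d 0F 2F 3F) (n∣ 1F)))
      (∣m⇒∣m*n (det3 b c d 0F 1F 3F) (n∣ 2F))) (∣m⇒∣m*n (det3 b c d 0F 1F 2F) (n∣ 3F))))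

-- `cramer` handles only the coefficient of the first row. Each other row is moved to the front by
-- adjacent swaps, which change the determinant only in sign.
kernel-trivial : ∀ {n} (A : Fin 4 → Fin 4 → ℤ) (z : Fin 4 → ℤ) → CoprimeTo (det 4 A) n →
  (∀ q → + n ∣ combine₄ (z 0F) (z 1F) (z 2F) (z 3F) (A 0F) (A 1F) (A 2F) (A 3F) q) →
  ∀ p → + n ∣ z p
kernel-trivial {n} A z cop n∣ = solution
  where
  a b c d : Fin 4 → ℤ
  a = A 0F
  b = A 1F
  c = A 2F
  d = A 3F

  step : ∀ {i} j → CoprimeTo i n → i ≡ - j → CoprimeTo j n
  step j cop refl = coprimeTo-neg j cop

  cop₀ : CoprimeTo (det4 a b c d) n
  cop₀ = subst (λ i → CoprimeTo i n) (det≡det4 A) cop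

  cop₁ : CoprimeTo (det4 b a c d) n
  cop₁ = step (det4 b a c d) cop₀ (det4-swap₁ a b c d)

  cop₂ : CoprimeTo (det4 c a b d) n
  cop₂ = step (det4 c a b d) (step (det4 a c b d) cop₀ (det4-swap₂ a b c d)) (det4-swap₁ a c b d)

  cop₃ : CoprimeTo (det4 d a b c) n
  cop₃ = step (det4 d a b c) (step (det4 a d b c) (step (det4 a b d c) cop₀
    (det4-swap₃ a b c d)) (det4-swap₂ a b d c)) (det4-swap₁ a d b c)

  rot₁ : ∀ w x y z → w + x + y + z ≡ x + w + y + z
  rot₁ = solve-∀
  rot₂ : ∀ w x y z → w + x + y + z ≡ y + w + x + z
  rot₂ = solve-∀
  rot₃ : ∀ w x y z → w + x + y + z ≡ z + w + x + y
  rot₃ = solve-∀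

  solution : ∀ p → + n ∣ z p
  solution 0F = cramer (z 0F) (z 1F) (z 2F) (z 3F) a b c d cop₀ n∣
  solution 1F = cramer (z 1F) (z 0F) (z 2F) (z 3F) b a c d cop₁
    (λ q → ∣-resp-≡ (rot₁ (z 0F * a q) _ _ _) (n∣ q))
  solution 2F = cramer (z 2F) (z 0F) (z 1F) (z 3F) c a b d cop₂
    (λ q → ∣-resp-≡ (rot₂ (z 0F * a q) _ _ _) (n∣ q))
  solution 3F = cramer (z 3F) (z 0F) (z 1F) (z 2F) d a b c cop₃
    (λ q → ∣-resp-≡ (rot₃ (z 0F * a q) _ _ _) (n∣ q))

-- Finite sums and permutations

-- Pigeonhole: if `j` were missed, punching it out would inject `Fin (suc n)` into `Fin n`.
injective⇒surjective : ∀ {n} {f : Fin n → Fin n} → Injective _≡_ _≡_ f → ∀ j → ∃ λ i → f i ≡ j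
injective⇒surjective {suc n} {f} inj j with any? (λ i → f i ≟ j)
... | yes hit = hit
... | no miss = contradiction (injective⇒≤ squeezed) ℕ.1+n≰n
  where
  j≢f : ∀ i → j ≢ f i
  j≢f i j≡fi = miss (i , sym j≡fi)

  squeezed : Injective _≡_ _≡_ (λ i → punchOut (j≢f i))
  squeezed {i} {i′} = inj ∘ punchOut-injective (j≢f i) (j≢f i′)

Σ<-suc : ∀ n f → Σ< (suc n) f ≡ Σ< n f ℕ.+ f n
Σ<-suc n f = begin
  Σ< (suc n) f                        ≡⟨ cong sum (map-upTo f (suc n)) ⟩
  sum (applyUpTo f (suc n))           ≡⟨ cong sum (applyUpTo-∷ʳ f n) ⟨
  sum (applyUpTo f n ∷ʳ f n)     ≡⟨ sum-++ (applyUpTo f n) (f n ∷ []) ⟩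
  sum (applyUpTo f n) ℕ.+ (f n ℕ.+ 0) ≡⟨ cong₂ ℕ._+_ (cong sum (sym (map-upTo f n))) (ℕ.+-identityʳ (f n)) ⟩
  Σ< n f ℕ.+ f n                      ∎
  where open ≡-Reasoning

Σ<-distrib-+ : ∀ n f g → Σ< n (λ t → f t ℕ.+ g t) ≡ Σ< n f ℕ.+ Σ< n g
Σ<-distrib-+ zero    f g = refl
Σ<-distrib-+ (suc n) f g = begin
  Σ< (suc n) (λ t → f t ℕ.+ g t)                ≡⟨ Σ<-suc n (λ t → f t ℕ.+ g t) ⟩
  Σ< n (λ t → f t ℕ.+ g t) ℕ.+ (f n ℕ.+ g n)    ≡⟨ cong (ℕ._+ (f n ℕ.+ g n)) (Σ<-distrib-+ n f g) ⟩
  Σ< n f ℕ.+ Σ< n g ℕ.+ (f n ℕ.+ g n)           ≡⟨ lemma (Σ< n f) (Σ< n g) (f n) (g n) ⟩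
  (Σ< n f ℕ.+ f n) ℕ.+ (Σ< n g ℕ.+ g n)         ≡⟨ cong₂ ℕ._+_ (Σ<-suc n f) (Σ<-suc n g) ⟨
  Σ< (suc n) f ℕ.+ Σ< (suc n) g                 ∎
  where
  open ≡-Reasoning
  lemma : ∀ a b c d → a ℕ.+ b ℕ.+ (c ℕ.+ d) ≡ a ℕ.+ c ℕ.+ (b ℕ.+ d)
  lemma = ℕ.solve-∀

Σ<-distribˡ-* : ∀ n k f → Σ< n (λ t → k ℕ.* f t) ≡ k ℕ.* Σ< n f
Σ<-distribˡ-* zero    k f = sym (ℕ.*-zeroʳ k)
Σ<-distribˡ-* (suc n) k f = begin
  Σ< (suc n) (λ t → k ℕ.* f t)            ≡⟨ Σ<-suc n (λ t → k ℕ.* f t) ⟩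
  Σ< n (λ t → k ℕ.* f t) ℕ.+ k ℕ.* f n    ≡⟨ cong (ℕ._+ k ℕ.* f n) (Σ<-distribˡ-* n k f) ⟩
  k ℕ.* Σ< n f ℕ.+ k ℕ.* f n              ≡⟨ ℕ.*-distribˡ-+ k (Σ< n f) (f n) ⟨
  k ℕ.* (Σ< n f ℕ.+ f n)                  ≡⟨ cong (k ℕ.*_) (Σ<-suc n f) ⟨
  k ℕ.* Σ< (suc n) f                      ∎
  where open ≡-Reasoning

-- Doubled, and stated for `suc k`, to avoid both division and truncated subtraction.
Σ<-id : ∀ k → Σ< (suc k) id ℕ.* 2 ≡ suc k ℕ.* k
Σ<-id zero    = refl
Σ<-id (suc k) = begin
  Σ< (suc (suc k)) id ℕ.* 2               ≡⟨ cong (ℕ._* 2) (Σ<-suc (suc k) id) ⟩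
  (Σ< (suc k) id ℕ.+ suc k) ℕ.* 2         ≡⟨ ℕ.*-distribʳ-+ 2 (Σ< (suc k) id) (suc k) ⟩
  Σ< (suc k) id ℕ.* 2 ℕ.+ suc k ℕ.* 2     ≡⟨ cong (ℕ._+ suc k ℕ.* 2) (Σ<-id k) ⟩
  suc k ℕ.* k ℕ.+ suc k ℕ.* 2             ≡⟨ lemma k ⟩
  suc (suc k) ℕ.* suc k                   ∎
  where
  open ≡-Reasoning
  lemma : ∀ k → suc k ℕ.* k ℕ.+ suc k ℕ.* 2 ≡ suc (suc k) ℕ.* suc k
  lemma = ℕ.solve-∀

Σ<≡sum : ∀ n f → Σ< n f ≡ FinSum.sum {n} (f ∘ toℕ)
Σ<≡sum n f = trans (cong sum (map-upTo f n)) (go n f)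
  where
  go : ∀ n f → sum (applyUpTo f n) ≡ FinSum.sum {n} (f ∘ toℕ)
  go zero    f = refl
  go (suc n) f = cong (f 0 ℕ.+_) (go n (f ∘ suc))

-- On `Fin n` the function becomes an injective self-map, hence a permutation, under which finite
-- sums are invariant.
Σ<-permute : ∀ n f → (∀ t → t < n → f t < n) →
  (∀ s t → s < n → t < n → f s ≡ f t → s ≡ t) → Σ< n f ≡ Σ< n id
Σ<-permute n f f<n f-inj = begin
  Σ< n f                          ≡⟨ Σ<≡sum n f ⟩
  FinSum.sum {n} (f ∘ toℕ)        ≡⟨ sum-cong-≗ (λ i → sym (toℕ-fromℕ< (bound i))) ⟩
  -- The left inverse law follows from the right one by injectivity of `π`.
  FinSum.sum {n} (toℕ ∘ π)        ≡⟨ sum-permute toℕ (permutation π π⁻¹ π∘π⁻¹ (λ i → π-inj (π∘π⁻¹ (π i)))) ⟨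
  FinSum.sum {n} toℕ              ≡⟨ Σ<≡sum n id ⟨
  Σ< n id                         ∎
  where
  open ≡-Reasoning
  bound : ∀ (i : Fin n) → f (toℕ i) < n
  bound i = f<n (toℕ i) (toℕ<n i)

  π π⁻¹ : Fin n → Fin n
  π i = fromℕ< (bound i)

  π-inj : Injective _≡_ _≡_ π
  π-inj {i} {j} eq = toℕ-injective
    (f-inj _ _ (toℕ<n i) (toℕ<n j) (fromℕ<-injective _ _ (bound i) (bound j) eq))

  π⁻¹ j = proj₁ (injective⇒surjective π-inj j)

  π∘π⁻¹ : ∀ j → π (π⁻¹ j) ≡ j
  π∘π⁻¹ j = proj₂ (injective⇒surjective π-inj j)

-- If `f s ≡ f t`, subtracting the two congruences leaves `u * (s - t)` divisible by `n`; cancelling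
-- the unit `u` shows that `f` is injective on S.
Σ<-affine : ∀ n f u c → CoprimeTo u n → (∀ t → t < n → f t < n) →
  (∀ t → t < n → + n ∣ + f t - (u * + t + c)) → Σ< n f ≡ Σ< n id
Σ<-affine n f u c cop f<n aff = Σ<-permute n f f<n λ s t s<n t<n fs≡ft →
  residue-unique s<n t<n (coprimeTo-cancel u (+ s - + t) cop
    (∣-resp-≡ (trans (cong (λ k → + f t - (u * + t + c) - (+ k - (u * + s + c))) fs≡ft)
                     (lemma (+ f t) u (+ s) (+ t) c))
              (∣m∣n⇒∣m-n (aff t t<n) (aff s s<n))))
  where
  lemma : ∀ y u s t c → y - (u * t + c) - (y - (u * s + c)) ≡ u * (s - t)
  lemma = solve-∀

-- Slopes of rows

-- 0F, 1F, 2F stand for the slopes -1, 0, 1, so that opposite is negation.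
Slope : Set
Slope = Fin 3

⟦_⟧ : Slope → ℤ
⟦ 0F ⟧ = -1ℤ
⟦ 1F ⟧ = 0ℤ
⟦ 2F ⟧ = 1ℤ

⟦opposite⟧ : ∀ s → ⟦ opposite s ⟧ ≡ - ⟦ s ⟧
⟦opposite⟧ 0F = refl
⟦opposite⟧ 1F = refl
⟦opposite⟧ 2F = refl

-- The bound on `f t` travels with the congruence because reflecting a coordinate uses truncated
-- subtraction.
HasSlope : ℕ → (ℕ → ℕ) → Slope → Set
HasSlope n f s = Σ ℤ λ c → ∀ t → t < n → f t < n × + n ∣ + f t - (⟦ s ⟧ * + t + c)

hasSlope-const : ∀ {n c} → c < n → HasSlope n (λ _ → c) 1F
hasSlope-const {n} {c} c<n = + c , λ t _ → c<n , divides 0ℤ (lemma (+ c) (+ t) (+ n))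
  where
  lemma : ∀ c t n → c - (+ 0 * t + c) ≡ + 0 * n
  lemma = solve-∀

hasSlope-id : ∀ {n} → HasSlope n id 2F
hasSlope-id {n} = 0ℤ , λ t t<n → t<n , divides 0ℤ (lemma (+ t) (+ n))
  where
  lemma : ∀ t n → t - (+ 1 * t + + 0) ≡ + 0 * n
  lemma = solve-∀

hasSlope-% : ∀ {n} .{{_ : NonZero n}} (f : ℕ → ℕ) s c →
  (∀ t → t < n → + n ∣ + f t - (⟦ s ⟧ * + t + c)) → HasSlope n (λ t → f t % n) s
hasSlope-% {n} f s c aff = c , λ t t<n → m%n<n (f t) n ,
  ∣-resp-≡ (lemma (+ f t) (+ (f t % n)) (⟦ s ⟧ * + t + c)) (∣m∣n⇒∣m-n (aff t t<n) (%-cong (f t) n))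
  where
  lemma : ∀ x y z → x - z - (x - y) ≡ y - z
  lemma = solve-∀

hasSlope-shift : ∀ {n} .{{_ : NonZero n}} c → HasSlope n (λ t → (t ℕ.+ c) % n) 2F
hasSlope-shift {n} c = hasSlope-% (ℕ._+ c) 2F (+ c) λ t _ → divides 0ℤ (lemma (+ t) (+ c) (+ n))
  where
  lemma : ∀ t c n → t + c - (+ 1 * t + c) ≡ + 0 * n
  lemma = solve-∀

-- The `n` added to keep the subtraction from truncating is the multiple of `n` in the congruence,
-- whence the quotient `1ℤ`.
hasSlope-antishift : ∀ {n} .{{_ : NonZero n}} c → HasSlope n (λ t → (c ℕ.+ (n ℕ.∸ t)) % n) 0F
hasSlope-antishift {n} c = hasSlope-% (λ t → c ℕ.+ (n ℕ.∸ t)) 0F (+ c) λ t t<n →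
  divides 1ℤ (trans (cong (λ k → + c + k - (-1ℤ * + t + + c)) (pos-∸ (ℕ.<⇒≤ t<n)))
                    (lemma (+ c) (+ n) (+ t)))
  where
  pos-∸ : ∀ {m n} → n ≤ m → + (m ℕ.∸ n) ≡ + m - + n
  pos-∸ {m} {n} n≤m = sym (trans (ℤ.m-n≡m⊖n m n) (ℤ.⊖-≥ n≤m))

  lemma : ∀ c n t → c + (n - t) - (- (+ 1) * t + c) ≡ + 1 * n
  lemma = solve-∀

hasSlope-reflect : ∀ {n f s} → HasSlope n f s → HasSlope n (λ t → n ℕ.∸ 1 ℕ.∸ f t) (opposite s)
hasSlope-reflect {zero} _ = 0ℤ , λ _ ()
hasSlope-reflect {suc k} {f} {s} (c , aff) = (+ k - c) , λ t t<n →
  let ft<n , n∣ = aff t t<n in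
  s≤s (ℕ.m∸n≤m k (f t)) ,
  ∣-resp-≡ (trans (lemma (+ k) (+ f t) ⟦ s ⟧ (+ t) c)
                  (cong₂ (λ x y → x - (y * + t + (+ k - c)))
                    (trans (ℤ.m-n≡m⊖n k (f t)) (ℤ.⊖-≥ (ℕ.≤-pred ft<n)))
                    (sym (⟦opposite⟧ s))))
           (∣m∣n⇒∣m-n {m = 0ℤ} (divides 0ℤ refl) n∣)
  where
  lemma : ∀ k x s t c → + 0 - (x - (s * t + c)) ≡ k - x - (- s * t + (k - c))
  lemma = solve-∀

hasSlope-insertAt : ∀ {n k} (P : ℕ → Point k) (d : Fin k → Slope) b v s →
  (∀ i → HasSlope n (λ t → P t i) (d i)) → HasSlope n v s →
  ∀ j → HasSlope n (λ t → insertAt (P t) b (v t) j) (insertAt d b s j)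
hasSlope-insertAt             P d zero    v s hP hv zero    = hv
hasSlope-insertAt             P d zero    v s hP hv (suc j) = hP j
hasSlope-insertAt {k = suc _} P d (suc b) v s hP hv zero    = hP zero
hasSlope-insertAt {k = suc _} P d (suc b) v s hP hv (suc j) =
  hasSlope-insertAt (λ t → P t ∘ suc) (d ∘ suc) b v s (hP ∘ suc) hv j

-- As `1F` encodes slope zero, `moving` says that not all slopes vanish.
record IsLine (n : ℕ) {k : ℕ} (P : ℕ → Point k) : Set where
  field
    slope    : Fin k → Slope
    hasSlope : ∀ i → HasSlope n (λ t → P t i) (slope i)
    moving   : ∃ λ i → slope i ≢ 1F

open IsLine

-- Insertion keeps all old coordinates, so the moving one survives at its shifted index
-- `punchIn b i`, whatever the new slope is.
isLine-insertAt : ∀ {n k} {P : ℕ → Point k} b v s → HasSlope n v s → IsLine n P →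
  IsLine n (λ t → insertAt (P t) b (v t))
isLine-insertAt {P = P} b v s hv L = record
  { slope    = insertAt (slope L) b s
  ; hasSlope = hasSlope-insertAt P (slope L) b v s (hasSlope L) hv
  ; moving   = let i , si≢0 = moving L in
      punchIn b i , λ eq → si≢0 (trans (sym (insertAt-punchIn (slope L) b s i)) eq)
  }

-- The inserted coordinate has slope zero for `fix`, a copied slope for `diag` and a negated one for
-- `anti`.
isLine-embed : ∀ {n k} {P : ℕ → Point k} (e : Con k) → Valid n e → IsLine n P →
  IsLine n (λ t → embed n e (P t))
isLine-embed (fix i c) c<n L = isLine-insertAt i (λ _ → c) 1F (hasSlope-const c<n) L
isLine-embed {P = P} (diag b a) _ L =
  isLine-insertAt b (λ t → P t a) (slope L a) (hasSlope L a) L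
isLine-embed {n} {P = P} (anti b a) _ L =
  isLine-insertAt b (λ t → n ℕ.∸ 1 ℕ.∸ P t a) (opposite (slope L a))
    (hasSlope-reflect {s = slope L a} (hasSlope L a)) L

-- Slopes and the coprimality conditions

-- A syntax for the linear forms in the coprimality conditions: their coefficient vectors are closed
-- data, so they can be compared with slope vectors by computation.
data Form : Set where
  var     : Fin 4 → Form
  total   : Form
  _⊕_ _⊖_ : Form → Form → Form
  2×_     : Form → Form

infixl 6 _⊕_ _⊖_
infix 7 2×_

eval : (Fin 4 → ℤ) → Form → ℤ
eval a (var m) = a m
eval a total   = a 0F + a 1F + a 2F + a 3F
eval a (F ⊕ G) = eval a F + eval a G
eval a (F ⊖ G) = eval a F - eval a G
eval a (2× F)  = + 2 * eval a F

coefficients : Form → Vec ℤ 4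
coefficients (var 0F) = 1ℤ ∷ 0ℤ ∷ 0ℤ ∷ 0ℤ ∷ []
coefficients (var 1F) = 0ℤ ∷ 1ℤ ∷ 0ℤ ∷ 0ℤ ∷ []
coefficients (var 2F) = 0ℤ ∷ 0ℤ ∷ 1ℤ ∷ 0ℤ ∷ []
coefficients (var 3F) = 0ℤ ∷ 0ℤ ∷ 0ℤ ∷ 1ℤ ∷ []
coefficients total    = replicate 4 1ℤ
coefficients (F ⊕ G)  = zipWith _+_ (coefficients F) (coefficients G)
coefficients (F ⊖ G)  = zipWith _-_ (coefficients F) (coefficients G)
coefficients (2× F)   = Vec.map (+ 2 *_) (coefficients F)

dot : Vec ℤ 4 → (Fin 4 → ℤ) → ℤ
dot (w ∷ x ∷ y ∷ z ∷ []) a = w * a 0F + x * a 1F + y * a 2F + z * a 3F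

-- Transfers an equality of coefficient vectors, found by computation, to the values of the forms at
-- arbitrary `a`.
dot-coefficients : ∀ a F → dot (coefficients F) a ≡ eval a F
dot-coefficients a (var 0F) = lemma (a 0F) (a 1F) (a 2F) (a 3F)
  where
  lemma : ∀ w x y z → + 1 * w + + 0 * x + + 0 * y + + 0 * z ≡ w
  lemma = solve-∀
dot-coefficients a (var 1F) = lemma (a 0F) (a 1F) (a 2F) (a 3F)
  where
  lemma : ∀ w x y z → + 0 * w + + 1 * x + + 0 * y + + 0 * z ≡ x
  lemma = solve-∀
dot-coefficients a (var 2F) = lemma (a 0F) (a 1F) (a 2F) (a 3F)
  where
  lemma : ∀ w x y z → + 0 * w + + 0 * x + + 1 * y + + 0 * z ≡ y
  lemma = solve-∀
dot-coefficients a (var 3F) = lemma (a 0F) (a 1F) (a 2F) (a 3F)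
  where
  lemma : ∀ w x y z → + 0 * w + + 0 * x + + 0 * y + + 1 * z ≡ z
  lemma = solve-∀
dot-coefficients a total = lemma (a 0F) (a 1F) (a 2F) (a 3F)
  where
  lemma : ∀ w x y z → + 1 * w + + 1 * x + + 1 * y + + 1 * z ≡ w + x + y + z
  lemma = solve-∀
dot-coefficients a (F ⊕ G) =
  trans (dot-+ (coefficients F) (coefficients G)) (cong₂ _+_ (dot-coefficients a F) (dot-coefficients a G))
  where
  lemma : ∀ w x y z w′ x′ y′ z′ a b c d →
    (w + w′) * a + (x + x′) * b + (y + y′) * c + (z + z′) * d ≡
    (w * a + x * b + y * c + z * d) + (w′ * a + x′ * b + y′ * c + z′ * d)
  lemma = solve-∀
  dot-+ : ∀ v v′ → dot (zipWith _+_ v v′) a ≡ dot v a + dot v′ a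
  dot-+ (w ∷ x ∷ y ∷ z ∷ []) (w′ ∷ x′ ∷ y′ ∷ z′ ∷ []) =
    lemma w x y z w′ x′ y′ z′ (a 0F) (a 1F) (a 2F) (a 3F)
dot-coefficients a (F ⊖ G) =
  trans (dot-- (coefficients F) (coefficients G)) (cong₂ _-_ (dot-coefficients a F) (dot-coefficients a G))
  where
  lemma : ∀ w x y z w′ x′ y′ z′ a b c d →
    (w - w′) * a + (x - x′) * b + (y - y′) * c + (z - z′) * d ≡
    (w * a + x * b + y * c + z * d) - (w′ * a + x′ * b + y′ * c + z′ * d)
  lemma = solve-∀
  dot-- : ∀ v v′ → dot (zipWith _-_ v v′) a ≡ dot v a - dot v′ a
  dot-- (w ∷ x ∷ y ∷ z ∷ []) (w′ ∷ x′ ∷ y′ ∷ z′ ∷ []) =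
    lemma w x y z w′ x′ y′ z′ (a 0F) (a 1F) (a 2F) (a 3F)
dot-coefficients a (2× F) = trans (dot-2* (coefficients F)) (cong (+ 2 *_) (dot-coefficients a F))
  where
  lemma : ∀ w x y z a b c d →
    (+ 2 * w) * a + (+ 2 * x) * b + (+ 2 * y) * c + (+ 2 * z) * d ≡ + 2 * (w * a + x * b + y * c + z * d)
  lemma = solve-∀
  dot-2* : ∀ v → dot (Vec.map (+ 2 *_) v) a ≡ + 2 * dot v a
  dot-2* (w ∷ x ∷ y ∷ z ∷ []) = lemma w x y z (a 0F) (a 1F) (a 2F) (a 3F)

dot-neg : ∀ v a → dot (Vec.map -_ v) a ≡ - dot v a
dot-neg (w ∷ x ∷ y ∷ z ∷ []) a = lemma w x y z (a 0F) (a 1F) (a 2F) (a 3F)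
  where
  lemma : ∀ w x y z a b c d → - w * a + - x * b + - y * c + - z * d ≡ - (w * a + x * b + y * c + z * d)
  lemma = solve-∀

conditions : Fin 4 → Fin 4 → List Form
conditions m m′ =
  var m ∷ var m ⊕ var m′ ∷ var m ⊖ var m′ ∷ total ⊖ var m ∷ total ∷ total ⊖ 2× var m ∷
  total ⊖ var m′ ⊖ 2× var m ∷ total ⊖ 2× var m′ ⊖ 2× var m ∷ []

conditions-coprime : ∀ n (a : Fin 4 → ℕ) → ColumnConditions n a → ∀ m m′ → m ≢ m′ →
  All (λ F → CoprimeTo (eval (+_ ∘ a) F) n) (conditions m m′)
conditions-coprime n a cc m m′ m≢m′ with cc m m′ m≢m′
... | c₁ , c₂ , c₃ , c₄ , c₅ , c₆ , c₇ , c₈ = c₁ ∷ c₂ ∷ c₃ ∷ c₄ ∷ c₅ ∷ c₆ ∷ c₇ ∷ c₈ ∷ []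

slopes : (w x y z : Slope) → Vec ℤ 4
slopes w x y z = ⟦ w ⟧ ∷ ⟦ x ⟧ ∷ ⟦ y ⟧ ∷ ⟦ z ⟧ ∷ []

Covered : Vec ℤ 4 → Set
Covered v = ∃₂ λ m m′ → m ≢ m′ ×
  Any (λ F → coefficients F ≡ v ⊎ coefficients F ≡ Vec.map -_ v) (conditions m m′)

AllZero : (w x y z : Slope) → Set
AllZero w x y z = w ≡ 1F × x ≡ 1F × y ≡ 1F × z ≡ 1F

-- Decided by evaluating all 81 cases. Up to sign, one nonzero slope gives `α_m`, and two give
-- `α_m ± α_m'`. Three give `B - α_m`, or `B - α_m' - 2α_m` if one sign differs. Four give `B`,
-- `B - 2α_m` or `B - 2α_m' - 2α_m`.
slopes-covered : ∀ w x y z → AllZero w x y z ⊎ Covered (slopes w x y z)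
slopes-covered = toWitness {a? = all? λ w → all? λ x → all? λ y → all? λ z →
  allZero? w x y z ⊎-dec covered? (slopes w x y z)} _
  where
  allZero? : ∀ w x y z → Dec (AllZero w x y z)
  allZero? w x y z = w ≟ 1F ×-dec x ≟ 1F ×-dec y ≟ 1F ×-dec z ≟ 1F

  _≟ᵛ_ : (u v : Vec ℤ 4) → Dec (u ≡ v)
  _≟ᵛ_ = Vec.≡-dec ℤ._≟_

  covered? : ∀ v → Dec (Covered v)
  covered? v = any? λ m → any? λ m′ → ¬? (m ≟ m′) ×-dec
    Any.any? (λ F → coefficients F ≟ᵛ v ⊎-dec coefficients F ≟ᵛ Vec.map -_ v) (conditions m m′)

covered-coprime : ∀ n (a : Fin 4 → ℕ) → ColumnConditions n a →
  ∀ v → Covered v → CoprimeTo (dot v (+_ ∘ a)) n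
covered-coprime n a cc v (m , m′ , m≢m′ , covered) =
  [ (λ eq → transport (evaluated eq) cop)
  , (λ eq → coprimeTo-neg (dot v a′) (transport (trans (evaluated eq) (dot-neg v a′)) cop))
  ]′ matches
  where
  a′ : Fin 4 → ℤ
  a′ = +_ ∘ a

  F : Form
  F = Any.lookup covered

  cop : CoprimeTo (eval a′ F) n
  cop = proj₁ (All.lookupAny (conditions-coprime n a cc m m′ m≢m′) covered)

  matches : coefficients F ≡ v ⊎ coefficients F ≡ Vec.map -_ v
  matches = proj₂ (All.lookupAny (conditions-coprime n a cc m m′ m≢m′) covered)

  transport : ∀ {i j} → i ≡ j → CoprimeTo i n → CoprimeTo j n
  transport refl c = c

  evaluated : ∀ {u} → coefficients F ≡ u → eval a′ F ≡ dot u a′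
  evaluated refl = sym (dot-coefficients a′ F)

slopes-coprime : ∀ n (a : Fin 4 → ℕ) → ColumnConditions n a → (s : Fin 4 → Slope) →
  (∃ λ i → s i ≢ 1F) → CoprimeTo (dot (slopes (s 0F) (s 1F) (s 2F) (s 3F)) (+_ ∘ a)) n
slopes-coprime n a cc s (i , si≢0) =
  [ (λ z → contradiction (allZero z i) si≢0)
  , covered-coprime n a cc (slopes (s 0F) (s 1F) (s 2F) (s 3F))
  ]′ (slopes-covered (s 0F) (s 1F) (s 2F) (s 3F))
  where
  allZero : AllZero (s 0F) (s 1F) (s 2F) (s 3F) → ∀ i → s i ≡ 1F
  allZero (eq , _)         0F = eq
  allZero (_ , eq , _)     1F = eq
  allZero (_ , _ , eq , _) 2F = eq
  allZero (_ , _ , _ , eq) 3F = eq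

-- The cube M

pos-linear : ∀ (a x : Fin 4 → ℕ) →
  + (a 0F ℕ.* x 0F ℕ.+ a 1F ℕ.* x 1F ℕ.+ a 2F ℕ.* x 2F ℕ.+ a 3F ℕ.* x 3F) ≡
  + a 0F * + x 0F + + a 1F * + x 1F + + a 2F * + x 2F + + a 3F * + x 3F
pos-linear a x = cong₂ _+_ (cong₂ _+_ (cong₂ _+_ (ℤ.pos-* (a 0F) (x 0F)) (ℤ.pos-* (a 1F) (x 1F)))
  (ℤ.pos-* (a 2F) (x 2F))) (ℤ.pos-* (a 3F) (x 3F))

Qcube-cong : ∀ n .{{_ : NonZero n}} α q x →
  + n ∣ combine₄ (+ x 0F) (+ x 1F) (+ x 2F) (+ x 3F)
          (+_ ∘ α 0F) (+_ ∘ α 1F) (+_ ∘ α 2F) (+_ ∘ α 3F) q - + Qcube n α q x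
Qcube-cong n α q x = subst (λ i → + n ∣ i - + Qcube n α q x)
  (trans (pos-linear (λ p → α p q) x)
         (lemma (+ α 0F q) (+ α 1F q) (+ α 2F q) (+ α 3F q) (+ x 0F) (+ x 1F) (+ x 2F) (+ x 3F)))
  (%-cong _ n)
  where
  lemma : ∀ a b c d w x y z → a * w + b * x + c * y + d * z ≡ w * a + x * b + y * c + z * d
  lemma = solve-∀

-- Along a line the cube is affine modulo `n`, and its multiplier `u`, the slopes paired with the
-- `α`, is a unit.
Σ<-Qcube : ∀ n .{{_ : NonZero n}} α q → ColumnConditions n (λ m → α m q) →
  ∀ {P} → IsLine n P → Σ< n (λ t → Qcube n α q (P t)) ≡ Σ< n id
Σ<-Qcube n α q cc {P} L = Σ<-affine n (λ t → Qcube n α q (P t)) u c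
  (slopes-coprime n a cc (slope L) (moving L)) (λ t _ → m%n<n _ n) affine
  where
  a : Fin 4 → ℕ
  a m = α m q

  s k : Fin 4 → ℤ
  s i = ⟦ slope L i ⟧
  k i = proj₁ (hasSlope L i)

  u c : ℤ
  u = dot (slopes (slope L 0F) (slope L 1F) (slope L 2F) (slope L 3F)) (+_ ∘ a)
  c = + a 0F * k 0F + + a 1F * k 1F + + a 2F * k 2F + + a 3F * k 3F

  lemma : ∀ Q t a₀ a₁ a₂ a₃ x₀ x₁ x₂ x₃ s₀ s₁ s₂ s₃ k₀ k₁ k₂ k₃ →
    (x₀ - (s₀ * t + k₀)) * a₀ + (x₁ - (s₁ * t + k₁)) * a₁
    + (x₂ - (s₂ * t + k₂)) * a₂ + (x₃ - (s₃ * t + k₃)) * a₃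
    - (x₀ * a₀ + x₁ * a₁ + x₂ * a₂ + x₃ * a₃ - Q) ≡
    Q - ((s₀ * a₀ + s₁ * a₁ + s₂ * a₂ + s₃ * a₃) * t + (a₀ * k₀ + a₁ * k₁ + a₂ * k₂ + a₃ * k₃))
  lemma = solve-∀

  affine : ∀ t → t < n → + n ∣ + Qcube n α q (P t) - (u * + t + c)
  -- The coordinate congruences, weighted by the `α`, are added, and the congruence of `Qcube` with
  -- its linear form is subtracted.
  affine t t<n = ∣-resp-≡
    (lemma (+ Qcube n α q (P t)) (+ t) (+ a 0F) (+ a 1F) (+ a 2F) (+ a 3F)
      (+ P t 0F) (+ P t 1F) (+ P t 2F) (+ P t 3F) (s 0F) (s 1F) (s 2F) (s 3F) (k 0F) (k 1F) (k 2F) (k 3F))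
    (∣m∣n⇒∣m-n (∣m∣n⇒∣m+n (∣m∣n⇒∣m+n (∣m∣n⇒∣m+n (term 0F) (term 1F)) (term 2F)) (term 3F))
      (Qcube-cong n α q (P t)))
    where
    term : ∀ i → + n ∣ (+ P t i - (s i * + t + k i)) * + a i
    term i = ∣m⇒∣m*n (+ a i) (proj₂ (proj₂ (hasSlope L i) t t<n))

-- Every digit cube contributes the same sum `T`, with `2T = n(n-1)`, and `(n³+n²+n+1)(n-1) = n⁴-1`.
Σ<-M4 : ∀ n .{{_ : NonZero n}} α → (∀ q → ColumnConditions n (λ m → α m q)) →
  ∀ {P} → IsLine n P → Σ< n (λ t → M4 n α (P t)) ≡ n ℕ.* (n ℕ.^ 4 ℕ.∸ 1) ℕ./ 2
Σ<-M4 n@(suc k) α cc {P} L = begin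
  Σ< n (λ t → n³ ℕ.* Q 0F t ℕ.+ n² ℕ.* Q 1F t ℕ.+ n ℕ.* Q 2F t ℕ.+ Q 3F t)
    ≡⟨ add (λ t → n³ ℕ.* Q 0F t ℕ.+ n² ℕ.* Q 1F t ℕ.+ n ℕ.* Q 2F t) (Q 3F)
         (add (λ t → n³ ℕ.* Q 0F t ℕ.+ n² ℕ.* Q 1F t) (λ t → n ℕ.* Q 2F t)
           (add (λ t → n³ ℕ.* Q 0F t) (λ t → n² ℕ.* Q 1F t) (scaled n³ 0F) (scaled n² 1F))
           (scaled n 2F))
         (Σ<-Qcube n α 3F (cc 3F) L) ⟩
  n³ ℕ.* T ℕ.+ n² ℕ.* T ℕ.+ n ℕ.* T ℕ.+ T
    -- Doubling under the division makes `Σ<-id` applicable.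
    ≡⟨ m*n/n≡m (n³ ℕ.* T ℕ.+ n² ℕ.* T ℕ.+ n ℕ.* T ℕ.+ T) 2 ⟨
  (n³ ℕ.* T ℕ.+ n² ℕ.* T ℕ.+ n ℕ.* T ℕ.+ T) ℕ.* 2 ℕ./ 2
    ≡⟨ cong (ℕ._/ 2) (trans (factor n³ n² n T)
         (trans (cong ((n³ ℕ.+ n² ℕ.+ n ℕ.+ 1) ℕ.*_) (Σ<-id k)) (geometric k))) ⟩
  n ℕ.* (n ℕ.^ 4 ℕ.∸ 1) ℕ./ 2 ∎
  where
  open ≡-Reasoning
  n³ n² T : ℕ
  n³ = n ℕ.^ 3
  n² = n ℕ.^ 2
  T = Σ< n id

  Q : Fin 4 → ℕ → ℕ
  Q q t = Qcube n α q (P t)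

  add : ∀ f g {a b} → Σ< n f ≡ a → Σ< n g ≡ b → Σ< n (λ t → f t ℕ.+ g t) ≡ a ℕ.+ b
  add f g refl refl = Σ<-distrib-+ n f g

  scaled : ∀ c q → Σ< n (λ t → c ℕ.* Q q t) ≡ c ℕ.* T
  scaled c q = trans (Σ<-distribˡ-* n c (Q q)) (cong (c ℕ.*_) (Σ<-Qcube n α q (cc q) L))

  factor : ∀ a b c t → (a ℕ.* t ℕ.+ b ℕ.* t ℕ.+ c ℕ.* t ℕ.+ t) ℕ.* 2 ≡ (a ℕ.+ b ℕ.+ c ℕ.+ 1) ℕ.* (t ℕ.* 2)
  factor = ℕ.solve-∀

  geometric : ∀ k → let n = suc k in
    (n ℕ.^ 3 ℕ.+ n ℕ.^ 2 ℕ.+ n ℕ.+ 1) ℕ.* (n ℕ.* k) ≡ n ℕ.* (n ℕ.^ 4 ℕ.∸ 1)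
  geometric k = trans (rearrange (suc k ℕ.^ 3 ℕ.+ suc k ℕ.^ 2 ℕ.+ suc k ℕ.+ 1) (suc k) k) (cong (λ i → suc k ℕ.* (i ℕ.∸ 1)) (telescope k))
    where
    rearrange : ∀ s n k → s ℕ.* (n ℕ.* k) ≡ n ℕ.* (s ℕ.* k)
    rearrange = ℕ.solve-∀
    -- The leading `1` is what `∸ 1` removes afterwards; the powers are written as they unfold.
    telescope : ∀ k →
      1 ℕ.+ ((1 ℕ.+ k) ℕ.* ((1 ℕ.+ k) ℕ.* ((1 ℕ.+ k) ℕ.* 1)) ℕ.+
        (1 ℕ.+ k) ℕ.* ((1 ℕ.+ k) ℕ.* 1) ℕ.+ (1 ℕ.+ k) ℕ.+ 1) ℕ.* k ≡
      (1 ℕ.+ k) ℕ.* ((1 ℕ.+ k) ℕ.* ((1 ℕ.+ k) ℕ.* ((1 ℕ.+ k) ℕ.* 1)))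
    telescope = ℕ.solve-∀

-- The four kinds of ROW are planar lines with slope pairs (1,0), (0,1), (1,1) and (1,-1), carried
-- into the cube by two embeddings.
M4-rows : ∀ n .{{_ : NonZero n}} α → (∀ q → ColumnConditions n (λ m → α m q)) →
  ∀ (e₁ : Con 3) → Valid n e₁ → ∀ (e₂ : Con 2) → Valid n e₂ →
  RowsSumTo n (sub n e₂ (sub n e₁ (M4 n α))) (n ℕ.* (n ℕ.^ 4 ℕ.∸ 1) ℕ./ 2)
M4-rows n α cc e₁ v₁ e₂ v₂ c c<n =
    row (line id (λ _ → c) 2F 1F hasSlope-id (hasSlope-const c<n) (0F , λ ()))
  , row (line (λ _ → c) id 1F 2F (hasSlope-const c<n) hasSlope-id (1F , λ ()))
  , row (line id (λ t → (t ℕ.+ c) % n) 2F 2F hasSlope-id (hasSlope-shift c) (0F , λ ()))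
  , row (line id (λ t → (c ℕ.+ (n ℕ.∸ t)) % n) 2F 0F hasSlope-id (hasSlope-antishift c) (0F , λ ()))
  where
  line : ∀ f g s s′ → HasSlope n f s → HasSlope n g s′ →
    (∃ λ i → (s Vector.∷ s′ Vector.∷ Vector.[]) i ≢ 1F) →
    IsLine n (λ t → f t Vector.∷ g t Vector.∷ Vector.[])
  line f g s s′ hf hg mv = record
    { slope    = s Vector.∷ s′ Vector.∷ Vector.[]
    ; hasSlope = λ { 0F → hf ; 1F → hg }
    ; moving   = mv
    }

  row : ∀ {P} → IsLine n P →
    Σ< n (λ t → M4 n α (embed n e₁ (embed n e₂ (P t)))) ≡ n ℕ.* (n ℕ.^ 4 ℕ.∸ 1) ℕ./ 2
  row L = Σ<-M4 n α cc (isLine-embed e₁ v₁ (isLine-embed e₂ v₂ L))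

-- Base-n digits and bijectivity of M

digits : ∀ n .{{_ : NonZero n}} → (Fin 4 → Fin 4 → ℕ) → Point 4 → Fin 4 → Fin n
digits n α x q = fromℕ< {Qcube n α q x} (m%n<n _ n)

-- `funToFin` reads a digit string in base `n`, most significant digit first, so bounds and
-- uniqueness of digits come from `Fin (n ^ 4)`.
M4≡toℕ : ∀ n .{{_ : NonZero n}} α x → M4 n α x ≡ toℕ (funToFin (digits n α x))
M4≡toℕ n α x = sym (trans
  (horner δ (value 0F)
    (horner (λ i → δ (suc i)) (value 1F)
      (horner (λ i → δ (suc (suc i))) (value 2F)
        (horner (λ i → δ (suc (suc (suc i)))) (value 3F) refl))))
  (lemma (n ℕ.^ 3) (n ℕ.^ 2) n (Qcube n α 0F x) (Qcube n α 1F x) (Qcube n α 2F x) (Qcube n α 3F x)))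
  where
  δ : Fin 4 → Fin n
  δ = digits n α x

  horner : ∀ {k} (f : Fin (suc k) → Fin n) {v w} → toℕ (f zero) ≡ v →
    toℕ (funToFin (λ i → f (suc i))) ≡ w → toℕ (funToFin f) ≡ n ℕ.^ k ℕ.* v ℕ.+ w
  horner f refl refl = toℕ-combine (f zero) (funToFin (λ i → f (suc i)))

  value : ∀ q → toℕ (δ q) ≡ Qcube n α q x
  value q = toℕ-fromℕ< (m%n<n _ n)

  -- The factors `c * 1` and `1`, and the final zero, are the unfolded `n ^ 1`, `n ^ 0` and empty
  -- digit string.
  lemma : ∀ a b c w x y z →
    a ℕ.* w ℕ.+ (b ℕ.* x ℕ.+ (c ℕ.* 1 ℕ.* y ℕ.+ (1 ℕ.* z ℕ.+ 0))) ≡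
    a ℕ.* w ℕ.+ b ℕ.* x ℕ.+ c ℕ.* y ℕ.+ z
  lemma = ℕ.solve-∀

-- Equal entries have equal digits, so `x - y` lies in the kernel of the matrix modulo `n`, which is
-- trivial.
M4-injective : ∀ n .{{_ : NonZero n}} α → CoprimeTo (det 4 (λ p q → + α p q)) n →
  ∀ x y → InS n x → InS n y → M4 n α x ≡ M4 n α y → ∀ i → x i ≡ y i
M4-injective n α cop x y x∈S y∈S Mx≡My i = residue-unique (x∈S i) (y∈S i)
  (kernel-trivial (λ p q → + α p q) (λ p → + x p - + y p) cop difference i)
  where
  sameDigits : funToFin (digits n α x) ≡ funToFin (digits n α y)
  sameDigits = toℕ-injective (trans (sym (M4≡toℕ n α x)) (trans Mx≡My (M4≡toℕ n α y)))

  sameQ : ∀ q → Qcube n α q x ≡ Qcube n α q y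
  sameQ q = fromℕ<-injective _ _ (m%n<n _ n) (m%n<n _ n)
    (trans (sym (finToFun-funToFin (digits n α x) q))
      (trans (cong (λ k → finToFun k q) sameDigits) (finToFun-funToFin (digits n α y) q)))

  lemma : ∀ Q a b c d w x y z w′ x′ y′ z′ →
    (w * a + x * b + y * c + z * d - Q) - (w′ * a + x′ * b + y′ * c + z′ * d - Q) ≡
    (w - w′) * a + (x - x′) * b + (y - y′) * c + (z - z′) * d
  lemma = solve-∀

  difference : ∀ q → + n ∣ combine₄ (+ x 0F - + y 0F) (+ x 1F - + y 1F) (+ x 2F - + y 2F) (+ x 3F - + y 3F)
    (+_ ∘ α 0F) (+_ ∘ α 1F) (+_ ∘ α 2F) (+_ ∘ α 3F) q
  difference q = ∣-resp-≡
    (lemma (+ Qcube n α q y) (+ α 0F q) (+ α 1F q) (+ α 2F q) (+ α 3F q)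
      (+ x 0F) (+ x 1F) (+ x 2F) (+ x 3F) (+ y 0F) (+ y 1F) (+ y 2F) (+ y 3F))
    (∣m∣n⇒∣m-n
      (subst (λ k → + n ∣ combine₄ (+ x 0F) (+ x 1F) (+ x 2F) (+ x 3F)
          (+_ ∘ α 0F) (+_ ∘ α 1F) (+_ ∘ α 2F) (+_ ∘ α 3F) q - + k) (sameQ q) (Qcube-cong n α q x))
      (Qcube-cong n α q y))

M4-bounded : ∀ n .{{_ : NonZero n}} α x → M4 n α x < n ℕ.^ 4
M4-bounded n α x = subst (_< n ℕ.^ 4) (sym (M4≡toℕ n α x)) (toℕ<n (funToFin (digits n α x)))

-- Once the points of S⁴ are numbered by `finToFun`, the cube is an injective self-map of
-- `Fin (n ^ 4)`, hence onto.
M4-surjective : ∀ n .{{_ : NonZero n}} α → CoprimeTo (det 4 (λ p q → + α p q)) n →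
  ∀ m → m < n ℕ.^ 4 → Σ (Point 4) λ x → InS n x × M4 n α x ≡ m
M4-surjective n α cop m m<n⁴ = point i , inS i , (begin
  M4 n α (point i)                        ≡⟨ M4≡toℕ n α (point i) ⟩
  toℕ (value i)                           ≡⟨ cong toℕ hit ⟩
  toℕ (fromℕ< m<n⁴)                       ≡⟨ toℕ-fromℕ< m<n⁴ ⟩
  m                                       ∎)
  where
  open ≡-Reasoning
  point : Fin (n ℕ.^ 4) → Point 4
  point k = toℕ ∘ finToFun {n} {4} k

  inS : ∀ k → InS n (point k)
  inS k i = toℕ<n (finToFun {n} {4} k i)

  value : Fin (n ℕ.^ 4) → Fin (n ℕ.^ 4)
  value k = funToFin (digits n α (point k))

  funToFin-cong : ∀ {k} {f g : Fin k → Fin n} → (∀ i → f i ≡ g i) → funToFin f ≡ funToFin g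
  funToFin-cong {zero}  f≗g = refl
  funToFin-cong {suc k} f≗g = cong₂ combine (f≗g zero) (funToFin-cong (f≗g ∘ suc))

  value-injective : Injective _≡_ _≡_ value
  value-injective {k} {l} eq = begin
    k                               ≡⟨ funToFin-finToFin {4} {n} k ⟨
    funToFin (finToFun {n} {4} k)   ≡⟨ funToFin-cong (λ i → toℕ-injective (same i)) ⟩
    funToFin (finToFun {n} {4} l)   ≡⟨ funToFin-finToFin {4} {n} l ⟩
    l                               ∎
    where
    same : ∀ i → point k i ≡ point l i
    same = M4-injective n α cop (point k) (point l) (inS k) (inS l)
      (trans (M4≡toℕ n α (point k)) (trans (cong toℕ eq) (sym (M4≡toℕ n α (point l)))))

  i : Fin (n ℕ.^ 4)
  i = proj₁ (injective⇒surjective value-injective (fromℕ< m<n⁴))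

  hit : value i ≡ fromℕ< m<n⁴
  hit = proj₂ (injective⇒surjective value-injective (fromℕ< m<n⁴))

mainTheorem10 : (n : ℕ) → .{{_ : NonZero n}} → n % 2 ≡ 1 →
    (α : Fin 4 → Fin 4 → ℕ) →
    (∀ p q → 1 ≤ α p q × α p q < n) →
    (∀ q → ColumnConditions n (λ m → α m q)) →
    CoprimeTo (det 4 (λ p q → + α p q)) n →
    IsMagicPandiagonal4D n (M4 n α)
mainTheorem10 n _ α _ cc cop =
    (λ x _ → M4-bounded n α x)
  , (λ m m<n⁴ →
      let x , x∈S , Mx≡m = M4-surjective n α cop m m<n⁴ in
      x , (x∈S , Mx≡m) , λ y y∈S My≡m → M4-injective n α cop y x y∈S x∈S (trans My≡m (sym Mx≡m)))
  , M4-rows n α cc
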